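{- For every natural number $m$, there exist infinitely many natural numbers $n$ such that $n+1, n+2, \ldots, n+m$ are all Zumkeller numbers.
   Context: A natural number (positive integer) $n$ is a Zumkeller number if the set of its positive divisors can be partitioned into two subsets with equal sums; equivalently, $\sigma(n)/2$ is a sum of distinct positive divisors of $n$, where $\sigma(n)$ is the sum of the positive divisors of $n$. -}

module Defs where

open import Data.Nat using (ℕ; suc; _*_; NonZero)
open import Data.Nat.Divisibility using (_∣?_)
open import Data.List using (List; filter; upTo; map)
open import Data.Nat.ListAction using (sum)
open import Data.List.Relation.Binary.Sublist.Propositional using (_⊆_)
open import Data.Product using (∃; _×_)
open import Relation.Binary.PropositionalEquality using (_≡_)

divisors : ℕ → List ℕ
divisors n = filter (_∣? n) (map suc (upTo n))

σ : ℕ → ℕ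
σ n = sum (divisors n)

Zumkeller : ℕ → Set
Zumkeller n = NonZero n × ∃ λ (S : List ℕ) → S ⊆ divisors n × 2 * sum S ≡ σ n

{-# OPTIONS --safe #-}

-- If a is Zumkeller and c is coprime to a, then a * c is Zumkeller. So it suffices to find
-- Zumkeller numbers coprime to any prescribed M: by the Chinese remainder theorem one can then
-- refine a progression n + M * t, one shift i at a time, so that n + M * t + i ≡ a (mod a²), hence
-- is a times a number coprime to a.
--
-- Let 4 ∣ k. A Zumkeller number a ≡ -1 (mod k) is a = b * q ^ α * L, where q = 1 + k and b is
-- the product of 1 + k, 1 + 2k, …, 1 + Jk, with J so large that the b / (1 + jk) add up to at
-- least B * b. The factor L is k - 1 times the product of a set X of numbers ≡ 1 (mod k) whose
-- subset sums contain all integers of an interval of length at least b and comparable to the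
-- sum of X, and q ^ α exceeds L. Every divisor d > b of a has a multiple y of b with y ∣ a and
-- d ≤ y < q * d; the divisors y / (1 + jk) lie below d and add up to at least B * d. Hence the
-- interval keeps absorbing the remaining divisors in increasing order, until it contains
-- σ(a) / 2. This is an integer, because 4 ∣ a + 1 implies 4 ∣ d + a / d for all d ∣ a.
module Submission where

open import Defs
open import Data.Nat
open import Data.Nat.Properties
open import Data.Nat.Divisibility
open import Data.Nat.DivMod using (_/_; _%_; m*[n/m]≡n; m%n<n; m*n/n≡m; /-monoˡ-≤; m≡m%n+[m/n]*n)
open import Data.Nat.Coprimality using (Coprime; coprime-divisor; gcd≡1⇒coprime)
open import Data.Nat.GCD using (gcd; gcd[m,n]∣m; gcd[m,n]∣n; c*gcd[m,n]≡gcd[cm,cn])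
open import Data.Nat.ListAction using (sum; product)
open import Data.Nat.ListAction.Properties using (sum-++; sum-↭; ∈⇒∣product)
open import Data.Nat.Tactic.RingSolver using (solve-∀)
open import Data.List using (List; []; _∷_; _++_; map; upTo)
open import Data.List.Membership.Propositional using (_∈_; _∉_)
open import Data.List.Membership.Propositional.Properties
open import Data.List.Membership.Propositional.Properties.WithK using (unique∧set⇒bag)
open import Data.List.Membership.DecPropositional _≟_ using (_∈?_)
open import Data.List.Relation.Binary.BagAndSetEquality using (∼bag⇒↭)
open import Data.List.Relation.Binary.Permutation.Propositional using (_↭_; refl; prep; swap; trans)
open import Data.List.Relation.Binary.Permutation.Propositional.Properties using (∈-resp-↭; shift)
open import Data.List.Relation.Binary.Sublist.Propositional using (_⊆_; []; _∷_; _∷ʳ_)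
open import Data.List.Relation.Unary.All as All using (All; []; _∷_)
import Data.List.Relation.Unary.All.Properties as All
open import Data.List.Relation.Unary.AllPairs using ([]; _∷_)
open import Data.List.Relation.Unary.Any using (here; there)
open import Data.List.Relation.Unary.Unique.Propositional using (Unique)
import Data.List.Relation.Unary.Unique.Propositional.Properties as Unique
open import Data.Product using (∃; _×_; _,_; proj₁; proj₂)
open import Data.Sum using (_⊎_; inj₁; inj₂)
open import Function using (mk⇔)
open import Relation.Nullary using (¬_; yes; no; contradiction)
open import Relation.Binary.PropositionalEquality using (_≡_; _≢_; refl; sym; cong; cong₂; subst; subst₂; module ≡-Reasoning) renaming (trans to ≡-trans)

-- Subset sums

infix 4 _⇝_

-- Only the sum of the chosen sublist is recorded, since this is what survives a permutation of the
-- list.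
data _⇝_ : List ℕ → ℕ → Set where
  done : [] ⇝ 0
  skip : ∀ {x xs t} → xs ⇝ t → x ∷ xs ⇝ t
  take : ∀ {x xs t} → xs ⇝ t → x ∷ xs ⇝ x + t

⇝-subst : ∀ {xs s t} → s ≡ t → xs ⇝ s → xs ⇝ t
⇝-subst refl p = p

⇝-resp-↭ : ∀ {xs ys t} → xs ↭ ys → xs ⇝ t → ys ⇝ t
⇝-resp-↭ refl s = s
⇝-resp-↭ (prep x p) (skip s) = skip (⇝-resp-↭ p s)
⇝-resp-↭ (prep x p) (take s) = take (⇝-resp-↭ p s)
⇝-resp-↭ (swap x y p) (skip (skip s)) = skip (skip (⇝-resp-↭ p s))
⇝-resp-↭ (swap x y p) (skip (take s)) = take (skip (⇝-resp-↭ p s))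
⇝-resp-↭ (swap x y p) (take (skip s)) = skip (take (⇝-resp-↭ p s))
⇝-resp-↭ (swap x y p) (take (take {t = t} s)) =
  ⇝-subst (+-swap y x t) (take (take (⇝-resp-↭ p s)))
  where
  +-swap : ∀ a b c → a + (b + c) ≡ b + (a + c)
  +-swap = solve-∀
⇝-resp-↭ (trans p q) s = ⇝-resp-↭ q (⇝-resp-↭ p s)

⇝⇒⊆ : ∀ {xs t} → xs ⇝ t → ∃ λ ys → ys ⊆ xs × sum ys ≡ t
⇝⇒⊆ done = [] , [] , refl
⇝⇒⊆ (skip s) = let ys , ys⊆xs , eq = ⇝⇒⊆ s in ys , _ ∷ʳ ys⊆xs , eq
⇝⇒⊆ (take {x} s) = let ys , ys⊆xs , eq = ⇝⇒⊆ s in x ∷ ys , refl ∷ ys⊆xs , cong (x +_) eq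

⊆⇒⇝ : ∀ {xs ys} → ys ⊆ xs → xs ⇝ sum ys
⊆⇒⇝ [] = done
⊆⇒⇝ (_ ∷ʳ p) = skip (⊆⇒⇝ p)
⊆⇒⇝ (refl ∷ p) = take (⊆⇒⇝ p)

⇝-≤-sum : ∀ {xs t} → xs ⇝ t → t ≤ sum xs
⇝-≤-sum done = z≤n
⇝-≤-sum (skip {x} s) = ≤-trans (⇝-≤-sum s) (m≤n+m _ x)
⇝-≤-sum (take {x} s) = +-monoʳ-≤ x (⇝-≤-sum s)

⇝-++ : ∀ {xs ys s t} → xs ⇝ s → ys ⇝ t → xs ++ ys ⇝ s + t
⇝-++ done q = q
⇝-++ (skip p) q = skip (⇝-++ p q)
⇝-++ {t = t} (take {x} {t = s} p) q = ⇝-subst (sym (+-assoc x s t)) (take (⇝-++ p q))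

⇝-map-* : ∀ e {xs t} → xs ⇝ t → map (e *_) xs ⇝ e * t
⇝-map-* e done = ⇝-subst (sym (*-zeroʳ e)) done
⇝-map-* e (skip p) = skip (⇝-map-* e p)
⇝-map-* e (take {x} {t = t} p) = ⇝-subst (sym (*-distribˡ-+ e x t)) (take (⇝-map-* e p))

sum-map-* : ∀ e xs → sum (map (e *_) xs) ≡ e * sum xs
sum-map-* e [] = sym (*-zeroʳ e)
sum-map-* e (x ∷ xs) = ≡-trans (cong (e * x +_) (sum-map-* e xs)) (sym (*-distribˡ-+ e x (sum xs)))

unique∧set⇒↭ : ∀ {xs ys : List ℕ} → Unique xs → Unique ys →
  (∀ {x} → x ∈ xs → x ∈ ys) → (∀ {x} → x ∈ ys → x ∈ xs) → xs ↭ ys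
unique∧set⇒↭ u v f g = ∼bag⇒↭ (unique∧set⇒bag u v (mk⇔ f g))

∉⇒All-≢ : ∀ {x : ℕ} {xs} → x ∉ xs → All (x ≢_) xs
∉⇒All-≢ {xs = xs} x∉xs = All.tabulate λ y∈xs x≡y → x∉xs (subst (_∈ xs) (sym x≡y) y∈xs)

unique-sum-≤ : ∀ {ys} xs → Unique ys → (∀ {y} → y ∈ ys → y ∈ xs) → sum ys ≤ sum xs
unique-sum-≤ {[]} xs [] ys⊆xs = z≤n
unique-sum-≤ {y ∷ ys} xs (y∉ys ∷ u) ys⊆xs with ∈-∃++ (ys⊆xs (here refl))
... | as , bs , refl = subst (y + sum ys ≤_) (sym (sum-↭ (shift y as bs)))
  (+-monoʳ-≤ y (unique-sum-≤ (as ++ bs) u rest))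
  where
  rest : ∀ {z} → z ∈ ys → z ∈ as ++ bs
  rest z∈ys with ∈-resp-↭ (shift y as bs) (ys⊆xs (there z∈ys))
  ... | here refl = contradiction refl (All.lookup y∉ys z∈ys)
  ... | there z∈ = z∈

-- Divisors

∣⇒NonZero : ∀ {d n} .{{_ : NonZero n}} → d ∣ n → NonZero d
∣⇒NonZero {zero} {suc n} d∣n with () ← 0∣⇒≡0 d∣n
∣⇒NonZero {suc d} _ = _

∈-divisors⁻ : ∀ {d n} → d ∈ divisors n → d ∣ n
∈-divisors⁻ {n = n} d∈ = proj₂ (∈-filter⁻ (_∣? n) {xs = map suc (upTo n)} d∈)

∈-divisors⁺ : ∀ {d n} .{{_ : NonZero n}} → d ∣ n → d ∈ divisors n
∈-divisors⁺ {zero} {suc n} d∣n with () ← 0∣⇒≡0 d∣n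
∈-divisors⁺ {suc d} {n} d∣n = ∈-filter⁺ (_∣? n) (∈-map⁺ suc (∈-upTo⁺ (∣⇒≤ d∣n))) d∣n

divisors-unique : ∀ n → Unique (divisors n)
divisors-unique n = Unique.filter⁺ (_∣? n) (Unique.map⁺ suc-injective (Unique.upTo⁺ n))

-- Take `f = gcd d m`. The cofactor `l` is coprime to `m / f` and divides `(m / f) * n`, hence
-- divides `n`.
∣-factor : ∀ {d} m n .{{_ : NonZero m}} → d ∣ m * n → ∃ λ f → ∃ λ l → d ≡ f * l × f ∣ m × l ∣ n
∣-factor {d} m n d∣mn with gcd[m,n]∣m d m | gcd[m,n]∣n d m
... | divides l d≡ | divides m′ m≡ =
  gcd d m , l , ≡-trans d≡ (*-comm l _) , gcd[m,n]∣n d m , l∣n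
  where
  g = gcd d m
  instance
    g≢0 : NonZero g
    g≢0 = ∣⇒NonZero (gcd[m,n]∣n d m)
  l⊥m′ : Coprime l m′
  l⊥m′ = gcd≡1⇒coprime (*-cancelˡ-≡ _ 1 g (begin
    g * gcd l m′ ≡⟨ c*gcd[m,n]≡gcd[cm,cn] g l m′ ⟩
    gcd (g * l) (g * m′) ≡⟨ cong₂ gcd (≡-trans (*-comm g l) (sym d≡)) (≡-trans (*-comm g m′) (sym m≡)) ⟩
    g ≡⟨ *-identityʳ g ⟨
    g * 1 ∎))
    where open ≡-Reasoning
  l∣n : l ∣ n
  l∣n = coprime-divisor l⊥m′ (*-cancelˡ-∣ g (subst₂ _∣_ (≡-trans d≡ (*-comm l g))
    (≡-trans (cong (_* n) (≡-trans m≡ (*-comm m′ g))) (*-assoc g m′ n)) d∣mn))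

-- Products of Zumkeller numbers with coprime cofactors

module _ (a c : ℕ) {{_ : NonZero a}} {{_ : NonZero c}} (a⊥c : Coprime a c) where

  -- When `es` lists the divisors of `c`, these are the divisors of `a * c` in blocks, each a scaled
  -- copy of the divisors of `a`, so that a half sum can be chosen block by block.
  multiples : List ℕ → List ℕ
  multiples [] = []
  multiples (e ∷ es) = map (e *_) (divisors a) ++ multiples es

  ∈-multiples⁻ : ∀ {x} es → x ∈ multiples es → ∃ λ e → ∃ λ d → e ∈ es × d ∣ a × x ≡ e * d
  ∈-multiples⁻ (e ∷ es) x∈ with ∈-++⁻ (map (e *_) (divisors a)) x∈
  ... | inj₁ x∈e = let d , d∈ , eq = ∈-map⁻ (e *_) x∈e in e , d , here refl , ∈-divisors⁻ d∈ , eq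
  ... | inj₂ x∈es = let e′ , d , e′∈ , d∣a , eq = ∈-multiples⁻ es x∈es in e′ , d , there e′∈ , d∣a , eq

  ∈-multiples⁺ : ∀ {e d es} → e ∈ es → d ∣ a → e * d ∈ multiples es
  ∈-multiples⁺ {e} (here refl) d∣a = ∈-++⁺ˡ (∈-map⁺ (e *_) (∈-divisors⁺ d∣a))
  ∈-multiples⁺ (there {x} e∈) d∣a = ∈-++⁺ʳ (map (x *_) (divisors a)) (∈-multiples⁺ e∈ d∣a)

  -- `e` and `d′` are coprime because they divide `c` and `a`. Applied in both directions, this
  -- makes the blocks disjoint.
  cofactor-∣ : ∀ {e e′ d d′} → e ∣ c → d′ ∣ a → e * d ≡ e′ * d′ → e ∣ e′
  cofactor-∣ {e} {e′} {d} {d′} e∣c d′∣a eq = coprime-divisor e⊥d′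
    (divides d (≡-trans (*-comm d′ e′) (≡-trans (sym eq) (*-comm e d))))
    where
    e⊥d′ : Coprime e d′
    e⊥d′ (i∣e , i∣d′) = a⊥c (∣-trans i∣d′ d′∣a , ∣-trans i∣e e∣c)

  multiples-unique : ∀ {es} → Unique es → All (_∣ c) es → Unique (multiples es)
  multiples-unique [] [] = []
  multiples-unique {e ∷ es} (e∉es ∷ u) (e∣c ∷ es∣c) =
    Unique.++⁺ (Unique.map⁺ (*-cancelˡ-≡ _ _ e) (divisors-unique a)) (multiples-unique u es∣c) disjoint
    where
    instance
      e≢0 : NonZero e
      e≢0 = ∣⇒NonZero e∣c
    disjoint : ∀ {x} → ¬ (x ∈ map (e *_) (divisors a) × x ∈ multiples es)
    disjoint (p , q) with ∈-map⁻ (e *_) p | ∈-multiples⁻ es q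
    ... | d , d∈ , refl | e′ , d′ , e′∈ , d′∣a , eq = All.lookup e∉es e′∈
      (∣-antisym (cofactor-∣ e∣c d′∣a eq)
                 (cofactor-∣ (All.lookup es∣c e′∈) (∈-divisors⁻ d∈) (sym eq)))

  multiples-⇝ : ∀ {t} es → divisors a ⇝ t → multiples es ⇝ sum es * t
  multiples-⇝ [] s = done
  multiples-⇝ {t} (e ∷ es) s =
    ⇝-subst (sym (*-distribʳ-+ t e (sum es))) (⇝-++ (⇝-map-* e s) (multiples-⇝ es s))

  sum-multiples : ∀ es → sum (multiples es) ≡ sum es * σ a
  sum-multiples [] = refl
  sum-multiples (e ∷ es) = begin
    sum (map (e *_) (divisors a) ++ multiples es) ≡⟨ sum-++ (map (e *_) (divisors a)) _ ⟩
    sum (map (e *_) (divisors a)) + sum (multiples es) ≡⟨ cong₂ _+_ (sum-map-* e (divisors a)) (sum-multiples es) ⟩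
    e * σ a + sum es * σ a ≡⟨ *-distribʳ-+ (σ a) e (sum es) ⟨
    (e + sum es) * σ a ∎
    where open ≡-Reasoning

  divisors-*-↭ : multiples (divisors c) ↭ divisors (a * c)
  divisors-*-↭ = unique∧set⇒↭ (multiples-unique (divisors-unique c) (All.tabulate ∈-divisors⁻))
    (divisors-unique (a * c)) to from
    where
    instance
      ac≢0 : NonZero (a * c)
      ac≢0 = m*n≢0 a c
    to : ∀ {x} → x ∈ multiples (divisors c) → x ∈ divisors (a * c)
    to x∈ with ∈-multiples⁻ (divisors c) x∈
    ... | e , d , e∈ , d∣a , refl =
      ∈-divisors⁺ (subst (_∣ a * c) (*-comm d e) (*-pres-∣ d∣a (∈-divisors⁻ e∈)))
    from : ∀ {x} → x ∈ divisors (a * c) → x ∈ multiples (divisors c)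
    from x∈ with ∣-factor a c (∈-divisors⁻ x∈)
    ... | f , l , refl , f∣a , l∣c =
      subst (_∈ multiples (divisors c)) (*-comm l f) (∈-multiples⁺ (∈-divisors⁺ l∣c) f∣a)

  zumkeller-* : Zumkeller a → Zumkeller (a * c)
  zumkeller-* (_ , S , S⊆ , 2S≡σ) =
    let T , T⊆ , eq = ⇝⇒⊆ (⇝-resp-↭ divisors-*-↭ (multiples-⇝ (divisors c) (⊆⇒⇝ S⊆)))
    in m*n≢0 a c , T , T⊆ , (begin
      2 * sum T ≡⟨ cong (2 *_) eq ⟩
      2 * (σ c * sum S) ≡⟨ move (σ c) (sum S) ⟩
      σ c * (2 * sum S) ≡⟨ cong (σ c *_) 2S≡σ ⟩
      σ c * σ a ≡⟨ sum-multiples (divisors c) ⟨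
      sum (multiples (divisors c)) ≡⟨ sum-↭ divisors-*-↭ ⟩
      σ (a * c) ∎)
    where
    open ≡-Reasoning
    move : ∀ x y → 2 * (x * y) ≡ x * (2 * y)
    move = solve-∀

-- Parity of σ

2∣n⊎2∣1+n : ∀ n → 2 ∣ n ⊎ 2 ∣ suc n
2∣n⊎2∣1+n zero = inj₁ (2 ∣0)
2∣n⊎2∣1+n (suc n) with 2∣n⊎2∣1+n n
... | inj₁ p = inj₂ (∣m∣n⇒∣m+n ∣-refl p)
... | inj₂ p = inj₁ p

-- Both d and e are odd, so 4 ∣ (d + 1) * (e + 1) = (d * e + 1) + (d + e).
4∣d+e : ∀ d e → 4 ∣ suc (d * e) → 4 ∣ d + e
4∣d+e d e 4∣1+de = ∣m+n∣m⇒∣n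
  (subst (4 ∣_) (expand d e) (*-pres-∣ (odd (m∣m*n {d} e)) (odd (n∣m*n d)))) 4∣1+de
  where
  expand : ∀ d e → suc d * suc e ≡ suc (d * e) + (d + e)
  expand = solve-∀
  odd : ∀ {x} → x ∣ d * e → 2 ∣ suc x
  odd {x} x∣de with 2∣n⊎2∣1+n x
  ... | inj₂ p = p
  ... | inj₁ p with () ← ∣1⇒≡1 (∣m+n∣m⇒∣n {m = d * e} {n = 1}
        (subst (2 ∣_) (+-comm 1 (d * e)) (∣-trans (divides 2 refl) 4∣1+de)) (∣-trans p x∣de))

unique-map : ∀ {f : ℕ → ℕ} {xs} → (∀ {x y} → x ∈ xs → y ∈ xs → f x ≡ f y → x ≡ y) →
  Unique xs → Unique (map f xs)
unique-map inj [] = []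
unique-map {f} {x ∷ xs} inj (x∉xs ∷ u) =
  All.map⁺ (All.tabulate λ y∈ eq → All.lookup x∉xs y∈ (inj (here refl) (there y∈) eq))
  ∷ unique-map (λ p q → inj (there p) (there q)) u

module _ (a : ℕ) {{_ : NonZero a}} (4∣1+a : 4 ∣ suc a) where

  -- The clause at zero gives a total function, which can be mapped over a list.
  codivisor : ℕ → ℕ
  codivisor zero = zero
  codivisor d@(suc _) = a / d

  *-codivisor : ∀ {d} → d ∣ a → d * codivisor d ≡ a
  *-codivisor {zero} 0∣a = sym (0∣⇒≡0 0∣a)
  *-codivisor {suc d} d∣a = m*[n/m]≡n d∣a

  codivisor-∣ : ∀ {d} → d ∣ a → codivisor d ∣ a
  codivisor-∣ {d} d∣a = divides d (sym (*-codivisor d∣a))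

  codivisor-injective : ∀ {d e} → d ∣ a → e ∣ a → codivisor d ≡ codivisor e → d ≡ e
  codivisor-injective {d} {e} d∣a e∣a eq = *-cancelʳ-≡ d e (codivisor d)
    {{∣⇒NonZero (codivisor-∣ d∣a)}}
    (≡-trans (*-codivisor d∣a) (≡-trans (sym (*-codivisor e∣a)) (cong (e *_) (sym eq))))

  codivisor-involutive : ∀ {d} → d ∣ a → codivisor (codivisor d) ≡ d
  codivisor-involutive {d} d∣a = *-cancelˡ-≡ _ _ (codivisor d) {{∣⇒NonZero (codivisor-∣ d∣a)}}
    (≡-trans (*-codivisor (codivisor-∣ d∣a)) (≡-trans (sym (*-codivisor d∣a)) (*-comm d _)))

  codivisors-↭ : map codivisor (divisors a) ↭ divisors a
  codivisors-↭ = unique∧set⇒↭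
    (unique-map (λ p q → codivisor-injective (∈-divisors⁻ p) (∈-divisors⁻ q)) (divisors-unique a))
    (divisors-unique a) to from
    where
    to : ∀ {x} → x ∈ map codivisor (divisors a) → x ∈ divisors a
    to x∈ with ∈-map⁻ codivisor x∈
    ... | d , d∈ , refl = ∈-divisors⁺ (codivisor-∣ (∈-divisors⁻ d∈))
    from : ∀ {x} → x ∈ divisors a → x ∈ map codivisor (divisors a)
    from x∈ = subst (_∈ _) (codivisor-involutive (∈-divisors⁻ x∈))
      (∈-map⁺ codivisor (∈-divisors⁺ (codivisor-∣ (∈-divisors⁻ x∈))))

  4∣sum : ∀ {ds} → All (_∣ a) ds → 4 ∣ sum ds + sum (map codivisor ds)
  4∣sum [] = 4 ∣0
  4∣sum {d ∷ ds} (d∣a ∷ ds∣a) = subst (4 ∣_) (regroup d (codivisor d) (sum ds) _)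
    (∣m∣n⇒∣m+n (4∣d+e d (codivisor d) (subst (λ x → 4 ∣ suc x) (sym (*-codivisor d∣a)) 4∣1+a)) (4∣sum ds∣a))
    where
    regroup : ∀ p q r s → (p + q) + (r + s) ≡ (p + r) + (q + s)
    regroup = solve-∀

  -- Since `codivisor` permutes the divisors, both sums in `4∣sum` equal `σ a`, and 4 divides
  -- `2 * σ a`.
  σ-even : 2 ∣ σ a
  σ-even = *-cancelˡ-∣ 2 (subst (4 ∣_) double (4∣sum (All.tabulate ∈-divisors⁻)))
    where
    double : σ a + sum (map codivisor (divisors a)) ≡ 2 * σ a
    double = cong (σ a +_) (≡-trans (sum-↭ codivisors-↭) (sym (+-identityʳ (σ a))))

-- Intervals of subset sums

Cover : List ℕ → ℕ → ℕ → Set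
Cover xs lo w = ∀ t → t ≤ w → xs ⇝ lo + t

-- Adding `d` shifts the interval to start at `lo + d`, at most one past the old end `lo + w`, so
-- the union has no gap.
Cover-∷ : ∀ {xs lo w d} → d ≤ suc w → Cover xs lo w → Cover (d ∷ xs) lo (d + w)
Cover-∷ {lo = lo} {w} {d} d≤1+w cov t t≤d+w with t ≤? w
... | yes t≤w = skip (cov t t≤w)
... | no t≰w = ⇝-subst eq (take (cov (t ∸ d) (m≤n+o⇒m∸n≤o t d t≤d+w)))
  where
  d≤t : d ≤ t
  d≤t = ≤-trans d≤1+w (≰⇒> t≰w)
  move : ∀ d lo s → d + (lo + s) ≡ lo + (d + s)
  move = solve-∀
  eq : d + (lo + (t ∸ d)) ≡ lo + t
  eq = ≡-trans (move d lo (t ∸ d)) (cong (lo +_) (m+[n∸m]≡n d≤t))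

-- The remaining divisors are added in increasing order; Δ, the total minus the width of the
-- covered interval, stays constant.
module Fill
  (a : ℕ) {{_ : NonZero a}} (xs : List ℕ) (lo w₀ Δ : ℕ)
  (xs-unique : Unique xs) (xs∣a : All (_∣ a) xs)
  (cover₀ : Cover xs lo w₀) (sum₀ : w₀ + Δ ≡ sum xs)
  (dense : ∀ {d} ys → d ∣ a → w₀ < d → (∀ {x} → x < d → x ∣ a → x ∈ ys) → d + Δ ≤ sum ys)
  where

  -- Entries of `xs` may be `n` or larger, so `complete` asks only that no divisor below `n` is
  -- missing.
  record Filled (n : ℕ) : Set where
    field
      ys : List ℕ
      ys-unique : Unique ys
      ys∣a : All (_∣ a) ys
      complete : ∀ {x} → x < n → x ∣ a → x ∈ ys
      w : ℕ
      w₀≤w : w₀ ≤ w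
      cover : Cover ys lo w
      total : w + Δ ≡ sum ys

  extend : ∀ {n} (F : Filled n) → (n ∣ a → n ∈ Filled.ys F) → Filled (suc n)
  extend {n} F n∈ = record { Filled F hiding (complete); complete = complete′ }
    where
    open Filled F
    complete′ : ∀ {x} → x < suc n → x ∣ a → x ∈ ys
    complete′ x<1+n x∣a with m<1+n⇒m<n∨m≡n x<1+n
    ... | inj₁ x<n = complete x<n x∣a
    ... | inj₂ refl = n∈ x∣a

  -- `Cover-∷` applies because `n ≤ w`: either `n ≤ w₀`, or `dense` gives `n + Δ ≤ sum ys = w + Δ`.
  insert : ∀ {n} (F : Filled n) → n ∣ a → n ∉ Filled.ys F → Filled (suc n)
  insert {n} F n∣a n∉ys = record
    { ys = n ∷ ys
    ; ys-unique = ∉⇒All-≢ n∉ys ∷ ys-unique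
    ; ys∣a = n∣a ∷ ys∣a
    ; complete = complete′
    ; w = n + w
    ; w₀≤w = ≤-trans w₀≤w (m≤n+m w n)
    ; cover = Cover-∷ (m≤n⇒m≤1+n n≤w) cover
    ; total = ≡-trans (+-assoc n w Δ) (cong (n +_) total)
    }
    where
    open Filled F
    complete′ : ∀ {x} → x < suc n → x ∣ a → x ∈ n ∷ ys
    complete′ x<1+n x∣a with m<1+n⇒m<n∨m≡n x<1+n
    ... | inj₁ x<n = there (complete x<n x∣a)
    ... | inj₂ refl = here refl
    n≤w : n ≤ w
    n≤w with n ≤? w₀
    ... | yes n≤w₀ = ≤-trans n≤w₀ w₀≤w
    ... | no n≰w₀ = +-cancelʳ-≤ Δ n w (subst (n + Δ ≤_) (sym total) (dense ys n∣a (≰⇒> n≰w₀) complete))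

  fill : ∀ n → Filled n
  fill zero = record
    { ys = xs ; ys-unique = xs-unique ; ys∣a = xs∣a ; complete = λ ()
    ; w = w₀ ; w₀≤w = ≤-refl ; cover = cover₀ ; total = sum₀ }
  fill (suc n) with fill n | n ∣? a
  ... | F | no n∤a = extend F λ n∣a → contradiction n∣a n∤a
  ... | F | yes n∣a with n ∈? Filled.ys F
  ...   | yes n∈ = extend F λ _ → n∈
  ...   | no n∉ = insert F n∣a n∉

  -- With all divisors included, `w + Δ = σ a = 2 * h`. As `lo + w` is a subset sum, `lo ≤ Δ`; then
  -- `Δ ≤ h` gives `lo ≤ h ≤ w`, so the interval contains `h`.
  zumkeller : 4 ∣ suc a → 2 * Δ ≤ σ a → Zumkeller a
  zumkeller 4∣1+a 2Δ≤σ with σ-even a 4∣1+a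
  ... | divides h σ≡h*2 =
    let S , S⊆ , eq = ⇝⇒⊆ (⇝-resp-↭ ys↭ (⇝-subst (m+[n∸m]≡n lo≤h) (cover (h ∸ lo) h∸lo≤w)))
    in it , S , S⊆ , ≡-trans (cong (2 *_) eq) (sym σ≡2h)
    where
    -- All divisors of `a` lie below `suc a`.
    open Filled (fill (suc a))
    it : NonZero a
    it = ≢-nonZero (≢-nonZero⁻¹ a)
    σ≡2h : σ a ≡ 2 * h
    σ≡2h = ≡-trans σ≡h*2 (*-comm h 2)
    ys↭ : ys ↭ divisors a
    ys↭ = unique∧set⇒↭ ys-unique (divisors-unique a) (λ x∈ → ∈-divisors⁺ (All.lookup ys∣a x∈))
      (λ x∈ → let x∣a = ∈-divisors⁻ x∈ in complete (s≤s (∣⇒≤ x∣a)) x∣a)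
    w+Δ≡2h : w + Δ ≡ 2 * h
    w+Δ≡2h = ≡-trans total (≡-trans (sum-↭ ys↭) σ≡2h)
    lo≤Δ : lo ≤ Δ
    lo≤Δ = +-cancelˡ-≤ w lo Δ (subst₂ _≤_ (+-comm lo w) (sym total) (⇝-≤-sum (cover w ≤-refl)))
    Δ≤h : Δ ≤ h
    Δ≤h = *-cancelˡ-≤ 2 (subst (2 * Δ ≤_) σ≡2h 2Δ≤σ)
    lo≤h : lo ≤ h
    lo≤h = ≤-trans lo≤Δ Δ≤h
    h≤w : h ≤ w
    h≤w = +-cancelʳ-≤ h h w (begin
      h + h ≡⟨ cong (h +_) (+-identityʳ h) ⟨
      2 * h ≡⟨ w+Δ≡2h ⟨
      w + Δ ≤⟨ +-monoʳ-≤ w Δ≤h ⟩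
      w + h ∎)
      where open ≤-Reasoning
    h∸lo≤w : h ∸ lo ≤ w
    h∸lo≤w = ≤-trans (m∸n≤m h lo) h≤w

n<2^n : ∀ n → n < 2 ^ n
n<2^n zero = s≤s z≤n
n<2^n (suc n) = begin-strict
  suc n ≤⟨ n<2^n n ⟩
  2 ^ n <⟨ m<m+n (2 ^ n) (m^n>0 2 n) ⟩
  2 ^ n + 2 ^ n ≡⟨ cong (2 ^ n +_) (+-identityʳ (2 ^ n)) ⟨
  2 ^ suc n ∎
  where open ≤-Reasoning

-- Numbers congruent to 1 modulo `k`

module _ (k : ℕ) {{_ : NonZero k}} where

  One : ℕ → Set
  One x = ∃ λ s → x ≡ suc (s * k)

  One-* : ∀ {x y} → One x → One y → One (x * y)
  One-* (s , refl) (t , refl) = s + t + s * t * k , expand s t k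
    where
    expand : ∀ s t k → suc (s * k) * suc (t * k) ≡ suc ((s + t + s * t * k) * k)
    expand = solve-∀

  One-^ : ∀ {x} n → One x → One (x ^ n)
  One-^ zero _ = 0 , refl
  One-^ (suc n) o = One-* o (One-^ n o)

  One-product : ∀ {xs} → All One xs → One (product xs)
  One-product [] = 0 , refl
  One-product (o ∷ os) = One-* o (One-product os)

  One⇒NonZero : ∀ {x} → One x → NonZero x
  One⇒NonZero (_ , refl) = _

  -- Wide intervals of subset sums of numbers ≡ 1 (mod k)

  residues : ℕ → List ℕ
  residues zero = []
  residues (suc ρ) = suc (suc ρ * k) ∷ residues ρ

  -- The coefficients of `k` in `residues ρ` add up to this, which therefore bounds the coefficient
  -- in every subset sum.
  triangle : ℕ → ℕ
  triangle zero = zero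
  triangle (suc ρ) = suc ρ + triangle ρ

  -- The `r` smallest entries, each congruent to 1, add up to `r` modulo `k`.
  residues-⇝ : ∀ ρ {r} → r ≤ ρ → ∃ λ z → z ≤ triangle ρ × residues ρ ⇝ r + z * k
  residues-⇝ zero z≤n = 0 , z≤n , done
  residues-⇝ (suc ρ) {r} r≤ρ with m≤n⇒m<n∨m≡n r≤ρ
  ... | inj₁ (s≤s r≤ρ′) = let z , z≤ , s = residues-⇝ ρ r≤ρ′ in z , ≤-trans z≤ (m≤n+m _ (suc ρ)) , skip s
  ... | inj₂ refl = let z , z≤ , s = residues-⇝ ρ ≤-refl in
    suc ρ + z , +-monoʳ-≤ (suc ρ) z≤ , ⇝-subst (regroup ρ z k) (take s)
    where
    regroup : ∀ ρ z k → suc (suc ρ * k) + (ρ + z * k) ≡ suc ρ + (suc ρ + z) * k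
    regroup = solve-∀

  residues-< : ∀ ρ {y} → ρ < y → All (_< suc (y * k)) (residues ρ)
  residues-< zero _ = []
  residues-< (suc ρ) ρ<y = s≤s (*-monoˡ-< k ρ<y) ∷ residues-< ρ (<-trans (n<1+n ρ) ρ<y)

  <⇒fresh : ∀ {x xs} → All (_< x) xs → All (x ≢_) xs
  <⇒fresh = All.map >⇒≢

  residues-unique : ∀ ρ → Unique (residues ρ)
  residues-unique zero = []
  residues-unique (suc ρ) = <⇒fresh (residues-< ρ (n<1+n ρ)) ∷ residues-unique ρ

  residues-One : ∀ ρ → All One (residues ρ)
  residues-One zero = []
  residues-One (suc ρ) = (suc ρ , refl) ∷ residues-One ρ

  -- Choosing one element from each added pair, whose difference is 2 ^ n * k, gives the binary
  -- expansions of all multiples of k below 2 ^ n * k; the residues then fill in the gaps.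
  ladder : ℕ → List ℕ
  ladder zero = residues k
  ladder (suc n) = suc (suc (suc k) * 2 ^ n * k) ∷ suc (suc k * 2 ^ n * k) ∷ ladder n

  -- The sum of the smaller entries of all pairs, corresponding to all binary digits being 0.
  ladder-lo : ℕ → ℕ
  ladder-lo zero = zero
  ladder-lo (suc n) = suc (suc k * 2 ^ n * k) + ladder-lo n

  rung-< : ∀ n → suc (suc k * 2 ^ n * k) < suc (suc (suc k) * 2 ^ n * k)
  rung-< n = s≤s (*-monoˡ-< k (*-monoˡ-< (2 ^ n) {{m^n≢0 2 n}} (n<1+n (suc k))))

  -- This rests on `k + 2 < 2 * (k + 1)`; the factors `suc k` and `suc (suc k)` in `ladder` thus
  -- keep all entries distinct.
  next-rung-< : ∀ n → suc (suc (suc k) * 2 ^ n * k) < suc (suc k * 2 ^ suc n * k)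
  next-rung-< n = s≤s (*-monoˡ-< k (subst (suc (suc k) * 2 ^ n <_) (*-assoc (suc k) 2 (2 ^ n))
    (*-monoˡ-< (2 ^ n) {{m^n≢0 2 n}} (begin-strict
      suc (suc k) <⟨ s≤s (s≤s (m<m+n k (>-nonZero⁻¹ k))) ⟩
      suc (suc (k + k)) ≡⟨ double k ⟩
      suc k * 2 ∎))))
    where
    open ≤-Reasoning
    double : ∀ k → suc (suc (k + k)) ≡ suc k * 2
    double = solve-∀

  ladder-< : ∀ n → All (_< suc (suc k * 2 ^ n * k)) (ladder n)
  ladder-< zero = subst (λ y → All (_< suc (y * k)) (residues k)) (sym (*-identityʳ (suc k)))
    (residues-< k (n<1+n k))
  ladder-< (suc n) = next-rung-< n ∷ <-trans (rung-< n) (next-rung-< n)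
    ∷ All.map (λ x< → <-trans x< (<-trans (rung-< n) (next-rung-< n))) (ladder-< n)

  ladder-unique : ∀ n → Unique (ladder n)
  ladder-unique zero = residues-unique k
  ladder-unique (suc n) = <⇒fresh (rung-< n ∷ All.map (λ x< → <-trans x< (rung-< n)) (ladder-< n))
    ∷ <⇒fresh (ladder-< n) ∷ ladder-unique n

  ladder-One : ∀ n → All One (ladder n)
  ladder-One zero = residues-One k
  ladder-One (suc n) = (suc (suc k) * 2 ^ n , refl) ∷ (suc k * 2 ^ n , refl) ∷ ladder-One n

  -- The offset `z` comes from the residues alone and is the same for all `i`. The leading binary
  -- digit of `i` decides which entry of the newest pair is taken.
  ladder-⇝ : ∀ n {r} → r ≤ k → ∃ λ z → z ≤ triangle k ×
    (∀ i → i < 2 ^ n → ladder n ⇝ ladder-lo n + (r + (z + i) * k))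
  ladder-⇝ zero {r} r≤k = let z , z≤ , s = residues-⇝ k r≤k in z , z≤ , λ where
    zero _ → ⇝-subst (cong (λ y → r + y * k) (sym (+-identityʳ z))) s
    (suc i) (s≤s ())
  ladder-⇝ (suc n) {r} r≤k with ladder-⇝ n r≤k
  ... | z , z≤ , s = z , z≤ , split
    where
    lower : ∀ p l r z i k → suc p + (l + (r + (z + i) * k)) ≡ suc p + l + (r + (z + i) * k)
    lower = solve-∀
    upper : ∀ k p l r z i → suc (suc (suc k) * p * k) + (l + (r + (z + i) * k))
      ≡ suc (suc k * p * k) + l + (r + (z + (p + i)) * k)
    upper = solve-∀
    split : ∀ i → i < 2 ^ suc n → ladder (suc n) ⇝ ladder-lo (suc n) + (r + (z + i) * k)
    split i i<2^1+n with i <? 2 ^ n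
    ... | yes i<2^n = skip (⇝-subst (lower (suc k * 2 ^ n * k) (ladder-lo n) r z i k) (take (s i i<2^n)))
    ... | no i≮2^n with m≤n⇒∃[o]m+o≡n (≮⇒≥ i≮2^n)
    ...   | j , refl = ⇝-subst (upper k (2 ^ n) (ladder-lo n) r z j) (take (skip (s j j<2^n)))
      where
      j<2^n : j < 2 ^ n
      j<2^n = +-cancelˡ-< (2 ^ n) j (2 ^ n)
        (subst (2 ^ n + j <_) (cong (2 ^ n +_) (+-identityʳ (2 ^ n))) i<2^1+n)

  ladder-cover : ∀ n u → triangle k + u < 2 ^ n →
    Cover (ladder n) (ladder-lo n + triangle k * k) (u * k)
  ladder-cover n u u< t t≤uk with ladder-⇝ n (<⇒≤ (m%n<n t k))
  -- The index `Z ∸ z + m` compensates for the offset `z`, which varies with the residue of `t`, so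
  -- that the coefficient of `k` is always `Z + m`.
  ... | z , z≤ , s = ⇝-subst eq (s (Z ∸ z + m) bound)
    where
    Z = triangle k
    m = t / k
    bound : Z ∸ z + m < 2 ^ n
    bound = ≤-<-trans (+-mono-≤ (m∸n≤m Z z) m≤u) u<
      where
      m≤u : m ≤ u
      m≤u = subst (m ≤_) (m*n/n≡m u k) (/-monoˡ-≤ k t≤uk)
    regroup : ∀ l r Z m k → l + (r + (Z + m) * k) ≡ l + Z * k + (r + m * k)
    regroup = solve-∀
    eq : ladder-lo n + (t % k + (z + (Z ∸ z + m)) * k) ≡ ladder-lo n + Z * k + t
    eq = begin
      ladder-lo n + (t % k + (z + (Z ∸ z + m)) * k)
        ≡⟨ cong (λ y → ladder-lo n + (t % k + y * k)) (+-assoc z (Z ∸ z) m) ⟨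
      ladder-lo n + (t % k + (z + (Z ∸ z) + m) * k)
        ≡⟨ cong (λ y → ladder-lo n + (t % k + (y + m) * k)) (m+[n∸m]≡n z≤) ⟩
      ladder-lo n + (t % k + (Z + m) * k) ≡⟨ regroup (ladder-lo n) (t % k) Z m k ⟩
      ladder-lo n + Z * k + (t % k + m * k) ≡⟨ cong (ladder-lo n + Z * k +_) (m≡m%n+[m/n]*n t k) ⟨
      ladder-lo n + Z * k + t ∎
      where open ≡-Reasoning

  -- Chosen so that the pair added to `ladder n` has sum at most `2 ^ n * growth`.
  growth : ℕ
  growth = 2 + (k + k + 3) * k

  ladder-sum-≤ : ∀ n → sum (ladder n) ≤ sum (residues k) + 2 ^ n * growth
  ladder-sum-≤ zero = m≤m+n _ _
  ladder-sum-≤ (suc n) = begin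
    suc (suc (suc k) * p * k) + (suc (suc k * p * k) + sum (ladder n)) ≡⟨ regroup k p (sum (ladder n)) ⟩
    2 + p * ((k + k + 3) * k) + sum (ladder n)
      ≤⟨ +-mono-≤ (+-monoˡ-≤ (p * ((k + k + 3) * k)) (*-monoˡ-≤ 2 (m^n>0 2 n))) (ladder-sum-≤ n) ⟩
    p * 2 + p * ((k + k + 3) * k) + (sum (residues k) + p * growth)
      ≡⟨ regroup′ k p (sum (residues k)) ⟩
    sum (residues k) + 2 * p * growth ∎
    where
    open ≤-Reasoning
    p = 2 ^ n
    regroup : ∀ k p s → suc (suc (suc k) * p * k) + (suc (suc k * p * k) + s)
      ≡ 2 + p * ((k + k + 3) * k) + s
    regroup = solve-∀
    regroup′ : ∀ k p s → p * 2 + p * ((k + k + 3) * k) + (s + p * (2 + (k + k + 3) * k))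
      ≡ s + 2 * p * (2 + (k + k + 3) * k)
    regroup′ = solve-∀

  -- This ratio depends on `k` alone, so `J` and `base k J` can be chosen from it before the width
  -- of the interval is known.
  sparsity : ℕ
  sparsity = 1 + 2 * growth

  wide-cover : ∀ b → ∃ λ xs → ∃ λ lo → ∃ λ w →
    Unique xs × All One xs × b ≤ w × Cover xs lo w × sum xs ≤ sparsity * w
  wide-cover b with m≤n⇒∃[o]m+o≡n (n<2^n (b + sum (residues k) + triangle k + suc (triangle k)))
  ... | o , eq = ladder n , ladder-lo n + Z * k , u * k
      , ladder-unique n , ladder-One n , b≤w , ladder-cover n u (≤-reflexive 2^n≡) , sum≤
    where
    Z = triangle k
    R = sum (residues k)
    -- So large that `u`, which is `2 ^ n - 1 - Z`, is at least `b`, `R` and `suc Z`; the last of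
    -- these gives `2 ^ n ≤ u + u`.
    n = b + R + Z + suc Z
    u = b + R + suc Z + o
    2^n≡ : suc (Z + u) ≡ 2 ^ n
    2^n≡ = ≡-trans (regroup b R Z o) eq
      where
      regroup : ∀ b R Z o → suc (Z + (b + R + suc Z + o)) ≡ suc (b + R + Z + suc Z) + o
      regroup = solve-∀
    b≤w : b ≤ u * k
    b≤w = ≤-trans (≤-trans (m≤m+n b (R + suc Z + o)) (≤-reflexive (regroup b R Z o))) (m≤m*n u k)
      where
      regroup : ∀ b R Z o → b + (R + suc Z + o) ≡ b + R + suc Z + o
      regroup = solve-∀
    sum≤ : sum (ladder n) ≤ sparsity * (u * k)
    sum≤ = begin
      sum (ladder n) ≤⟨ ladder-sum-≤ n ⟩
      R + 2 ^ n * growth ≤⟨ +-mono-≤ R≤u (*-monoˡ-≤ growth 2^n≤2u) ⟩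
      u + (u + u) * growth ≡⟨ regroup u growth ⟩
      sparsity * u ≤⟨ *-monoʳ-≤ sparsity (m≤m*n u k) ⟩
      sparsity * (u * k) ∎
      where
      open ≤-Reasoning
      regroup : ∀ u g → u + (u + u) * g ≡ (1 + 2 * g) * u
      regroup = solve-∀
      R≤u : R ≤ u
      R≤u = ≤-trans (m≤n+m R b) (≤-trans (m≤m+n (b + R) (suc Z)) (m≤m+n (b + R + suc Z) o))
      2^n≤2u : 2 ^ n ≤ u + u
      2^n≤2u = subst (_≤ u + u) 2^n≡ (+-monoˡ-≤ u (≤-trans (m≤n+m (suc Z) (b + R)) (m≤m+n (b + R + suc Z) o)))

  -- The harmonic series along 1 + k, 1 + 2k, … diverges

  base : ℕ → ℕ
  base zero = 1
  base (suc J) = suc (suc J * k) * base J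

  -- The numbers `base J / (1 + j * k)` for `j` from `J` down to 1; their sum divided by `base J` is
  -- the partial sum of the series.
  quotients : ℕ → List ℕ
  quotients zero = []
  quotients (suc J) = base J ∷ map (suc (suc J * k) *_) (quotients J)

  base-One : ∀ J → One (base J)
  base-One zero = 0 , refl
  base-One (suc J) = One-* (suc J , refl) (base-One J)

  base≢0 : ∀ J → NonZero (base J)
  base≢0 J = One⇒NonZero (base-One J)

  -- No denominator exceeds `1 + J * k`. Hence the next head, `base J`, is smaller than all the
  -- rescaled older quotients.
  quotients-≥ : ∀ J → All (λ q → base J ≤ suc (J * k) * q) (quotients J)
  quotients-≥ zero = []
  quotients-≥ (suc J) = ≤-refl ∷ All.map⁺ (All.map (λ {q} le → *-monoʳ-≤ (suc (suc J * k))
    (≤-trans le (*-monoˡ-≤ q (s≤s (m≤n+m (J * k) k))))) (quotients-≥ J))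

  quotients-unique : ∀ J → Unique (quotients J)
  quotients-unique zero = []
  quotients-unique (suc J) =
    All.map⁺ (All.map (λ {q} le → <⇒≢ (fresh q le)) (quotients-≥ J))
    ∷ Unique.map⁺ (*-cancelˡ-≡ _ _ (suc (suc J * k))) (quotients-unique J)
    where
    fresh : ∀ q → base J ≤ suc (J * k) * q → base J < suc (suc J * k) * q
    fresh zero le = contradiction (n≤0⇒n≡0 (≤-trans le (≤-reflexive (*-zeroʳ (suc (J * k))))))
      (≢-nonZero⁻¹ (base J) {{base≢0 J}})
    fresh q@(suc _) le = ≤-<-trans le (*-monoˡ-< q (s≤s (m<n+m (J * k) (>-nonZero⁻¹ k))))

  quotients-∣ : ∀ J → All (_∣ base J) (quotients J)
  quotients-∣ zero = []
  quotients-∣ (suc J) = n∣m*n (suc (suc J * k)) ∷ All.map⁺ (All.map (*-monoʳ-∣ (suc (suc J * k))) (quotients-∣ J))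

  -- The smallest denominator is `1 + k`; this is what later puts the divisors `y / (1 + j * k)`
  -- below `d` when `y < suc k * d`.
  quotients-≤ : ∀ J → All (λ q → suc k * q ≤ base J) (quotients J)
  quotients-≤ zero = []
  quotients-≤ (suc J) = *-monoˡ-≤ (base J) (s≤s (m≤m+n k (J * k)))
    ∷ All.map⁺ (All.map (λ {q} le → subst (_≤ g * base J) (swap-* g k q) (*-monoʳ-≤ g le)) (quotients-≤ J))
    where
    g = suc (suc J * k)
    swap-* : ∀ g k q → g * (suc k * q) ≡ suc k * (g * q)
    swap-* = solve-∀

  module _ (s J : ℕ) {{_ : NonZero J}} (H≥ : s * base J ≤ 3 * k * sum (quotients J)) where

    G : ℕ
    G = suc ((J + J) * k)

    -- With denominators cleared: the partial sum is at least `s / (3 * k) + n / G`, because each of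
    -- the `n` new denominators is at most `G`.
    block : ∀ n → n ≤ J → (s * G + 3 * k * n) * base (n + J) ≤ 3 * k * G * sum (quotients (n + J))
    block zero _ = begin
      (s * G + 3 * k * 0) * base J ≡⟨ left s G k (base J) ⟩
      G * (s * base J) ≤⟨ *-monoʳ-≤ G H≥ ⟩
      G * (3 * k * sum (quotients J)) ≡⟨ right G k (sum (quotients J)) ⟩
      3 * k * G * sum (quotients J) ∎
      where
      open ≤-Reasoning
      left : ∀ s G k b → (s * G + 3 * k * 0) * b ≡ G * (s * b)
      left = solve-∀
      right : ∀ G k h → G * (3 * k * h) ≡ 3 * k * G * h
      right = solve-∀
    block (suc n) n<J = begin
      (s * G + 3 * k * suc n) * (g * b) ≡⟨ left s G k n g b ⟩
      g * ((s * G + 3 * k * n) * b) + 3 * k * (g * b)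
        ≤⟨ +-mono-≤ (*-monoʳ-≤ g (block n (<⇒≤ n<J))) (*-monoʳ-≤ (3 * k) (*-monoˡ-≤ b g≤G)) ⟩
      g * (3 * k * G * h) + 3 * k * (G * b) ≡⟨ right k G g b h ⟩
      3 * k * G * (b + g * h) ≡⟨ cong (λ y → 3 * k * G * (b + y)) (sum-map-* g (quotients (n + J))) ⟨
      3 * k * G * sum (quotients (suc n + J)) ∎
      where
      open ≤-Reasoning
      g = suc (suc (n + J) * k)
      b = base (n + J)
      h = sum (quotients (n + J))
      g≤G : g ≤ G
      g≤G = s≤s (*-monoˡ-≤ k (+-monoˡ-≤ J n<J))
      left : ∀ s G k n g b → (s * G + 3 * k * suc n) * (g * b) ≡ g * ((s * G + 3 * k * n) * b) + 3 * k * (g * b)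
      left = solve-∀
      right : ∀ k G g b h → g * (3 * k * G * h) + 3 * k * (G * b) ≡ 3 * k * G * (b + g * h)
      right = solve-∀

    -- Oresme's argument: the `J` new terms contribute at least `J / G`, which is at least
    -- `1 / (3 * k)`.
    doubling : suc s * base (J + J) ≤ 3 * k * sum (quotients (J + J))
    doubling = *-cancelˡ-≤ G (begin
      G * (suc s * base (J + J)) ≡⟨ left G s (base (J + J)) ⟩
      (s * G + G) * base (J + J) ≤⟨ *-monoˡ-≤ (base (J + J)) (+-monoʳ-≤ (s * G) G≤) ⟩
      (s * G + 3 * k * J) * base (J + J) ≤⟨ block J ≤-refl ⟩
      3 * k * G * sum (quotients (J + J)) ≡⟨ right G k (sum (quotients (J + J))) ⟩
      G * (3 * k * sum (quotients (J + J))) ∎)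
      where
      open ≤-Reasoning
      left : ∀ G s b → G * (suc s * b) ≡ (s * G + G) * b
      left = solve-∀
      right : ∀ G k h → 3 * k * G * h ≡ G * (3 * k * h)
      right = solve-∀
      G≤ : G ≤ 3 * k * J
      G≤ = ≤-trans (+-monoˡ-≤ ((J + J) * k) (>-nonZero⁻¹ (J * k) {{m*n≢0 J k}})) (≤-reflexive (regroup J k))
        where
        regroup : ∀ J k → J * k + (J + J) * k ≡ 3 * k * J
        regroup = solve-∀

  divergence : ∀ s → ∃ λ J → NonZero J × s * base J ≤ 3 * k * sum (quotients J)
  -- Doubling needs a positive start.
  divergence zero = 1 , _ , z≤n
  divergence (suc s) with divergence s
  ... | J@(suc _) , _ , H≥ = J + J , _ , doubling s J H≥

  abundance : ∀ B → ∃ λ J → B * base J ≤ sum (quotients J)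
  abundance B with divergence (3 * k * B)
  ... | J , _ , H≥ = J , *-cancelˡ-≤ (3 * k) {{m*n≢0 3 k}} (subst (_≤ 3 * k * sum (quotients J)) (*-assoc (3 * k) B (base J)) H≥)

-- Zumkeller numbers in the residue class -1

-- Lower the exponent until the power times `b` drops below `f`; the exponent just before works.
-- Reaching exponent 0 would contradict `b < f`.
power-between : ∀ b q {f} α → b < f → f ≤ b * q ^ α → ∃ λ v → v ≤ α × f ≤ b * q ^ v × b * q ^ v < q * f
power-between b q zero b<f f≤ = contradiction (≤-trans f≤ (≤-reflexive (*-identityʳ b))) (<⇒≱ b<f)
power-between b q {f} (suc α) b<f f≤ with f ≤? b * q ^ α
... | yes f≤′ = let v , v≤ , le , lt = power-between b q α b<f f≤′ in v , m≤n⇒m≤1+n v≤ , le , lt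
... | no f≰ with q
...   | zero = contradiction (≤-trans f≤ (≤-reflexive (*-zeroʳ b))) (<⇒≱ (≤-<-trans z≤n b<f))
...   | q@(suc _) = suc α , ≤-refl , f≤ , subst (_< q * f) (swap-* b q (q ^ α)) (*-monoʳ-< q (≰⇒> f≰))
  where
  swap-* : ∀ b q p → q * (b * p) ≡ b * (q * p)
  swap-* = solve-∀

^-monoʳ-∣ : ∀ q {v α} → v ≤ α → q ^ v ∣ q ^ α
^-monoʳ-∣ q {v} v≤α with m≤n⇒∃[o]m+o≡n v≤α
... | o , refl = subst (q ^ v ∣_) (sym (^-distribˡ-+-* q v o)) (m∣m*n (q ^ o))

module _ (b q α L : ℕ) {{_ : NonZero b}} {{_ : NonZero q}} {{_ : NonZero L}} (L≤q^α : L ≤ q ^ α) where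

  private
    instance
      q^α≢0 : NonZero (q ^ α)
      q^α≢0 = m^n≢0 q α
      bq^α≢0 : NonZero (b * q ^ α)
      bq^α≢0 = m*n≢0 b (q ^ α)

  -- For large d = f * l with f ∣ b * q ^ α and l ∣ L, the factor l is kept and f is replaced.
  multiple-above : ∀ {d} → d ∣ b * q ^ α * L → b < d →
    ∃ λ m → b * m ∣ b * q ^ α * L × d ≤ b * m × b * m < q * d
  multiple-above {d} d∣a b<d with d ≤? b * q ^ α
  ... | yes d≤ = let v , v≤α , le , lt = power-between b q α b<d d≤ in
    q ^ v , ∣-trans (*-monoʳ-∣ b (^-monoʳ-∣ q v≤α)) (m∣m*n L) , le , lt
  ... | no d≰ with ∣-factor (b * q ^ α) L d∣a
  ...   | f , l , refl , f∣ , l∣L =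
    let v , v≤α , le , lt = power-between b q α b<f (∣⇒≤ f∣) in
    q ^ v * l
    , subst (_∣ b * q ^ α * L) (*-assoc b (q ^ v) l) (*-pres-∣ (*-monoʳ-∣ b (^-monoʳ-∣ q v≤α)) l∣L)
    , subst (f * l ≤_) (*-assoc b (q ^ v) l) (*-monoˡ-≤ l le)
    , subst₂ _<_ (*-assoc b (q ^ v) l) (*-assoc q f l) (*-monoˡ-< l lt)
    where
    instance
      l≢0 : NonZero l
      l≢0 = ∣⇒NonZero l∣L
    -- From `l ≤ L ≤ q ^ α` follows `b * l ≤ b * q ^ α < f * l`.
    b<f : b < f
    b<f = *-cancelʳ-< l b f (≤-<-trans (*-monoʳ-≤ b (≤-trans (∣⇒≤ l∣L) L≤q^α)) (≰⇒> d≰))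

4∣1+n⇒n≢0 : ∀ {n} → 4 ∣ suc n → NonZero n
4∣1+n⇒n≢0 {zero} 4∣1 with () ← ∣1⇒≡1 4∣1
4∣1+n⇒n≢0 {suc _} _ = _

module _ (k′ : ℕ) (4∣k : 4 ∣ suc k′) where

  private
    k = suc k′
    q = suc k
    C = sparsity k
    -- Serves two bounds: `d + C * d` in `dense` and `2 * C * a` in `2Δ≤σ`.
    B = 1 + 2 * C

  module Construct (J : ℕ) (abundant : B * base k J ≤ sum (quotients k J))
    (xs : List ℕ) (lo w : ℕ) (xs-unique : Unique xs) (xs-One : All (One k) xs)
    (b≤w : base k J ≤ w) (cover : Cover xs lo w) (sum≤ : sum xs ≤ C * w) where

    b = base k J
    L = k′ * product xs
    -- Then `q ^ α` exceeds `L`, as `multiple-above` requires, and also `w`, so that `w < a`.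
    α = L + w
    a = b * q ^ α * L

    instance
      b≢0 : NonZero b
      b≢0 = base≢0 k J
      L≢0 : NonZero L
      L≢0 = m*n≢0 k′ (product xs) {{4∣1+n⇒n≢0 4∣k}} {{One⇒NonZero k (One-product k xs-One)}}
      q^α≢0 : NonZero (q ^ α)
      q^α≢0 = m^n≢0 q α
      bq^α≢0 : NonZero (b * q ^ α)
      bq^α≢0 = m*n≢0 b (q ^ α)
      a≢0 : NonZero a
      a≢0 = m*n≢0 (b * q ^ α) L

    α<q^α : α < q ^ α
    α<q^α = <-≤-trans (n<2^n α) (^-monoˡ-≤ α (s≤s (s≤s z≤n)))

    w<a : w < a
    w<a = begin-strict
      w ≤⟨ m≤n+m w L ⟩
      α <⟨ α<q^α ⟩
      q ^ α ≤⟨ m≤n*m (q ^ α) b ⟩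
      b * q ^ α ≤⟨ m≤m*n (b * q ^ α) L ⟩
      a ∎
      where open ≤-Reasoning

    -- For the multiple `b * m` of `b` near `d`, the divisors `m * x` with `x` in `quotients k J`
    -- are below `d` since `q * x ≤ b` and `b * m < q * d`. They lie in `ys` and add up to at least
    -- `B * (b * m)`.
    abundant-below : ∀ {d} ys → d ∣ a → w < d → (∀ {x} → x < d → x ∣ a → x ∈ ys) → B * d ≤ sum ys
    abundant-below {d} ys d∣a w<d complete
      with multiple-above b q α L (≤-trans (m≤m+n L w) (<⇒≤ α<q^α)) d∣a (≤-<-trans b≤w w<d)
    ... | zero , _ , d≤ , _ = contradiction (≤-trans d≤ (≤-reflexive (*-zeroʳ b))) (<⇒≱ (≤-<-trans z≤n w<d))
    ... | m@(suc _) , bm∣a , d≤bm , bm<qd = begin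
      B * d ≤⟨ *-monoʳ-≤ B d≤bm ⟩
      B * (b * m) ≡⟨ swap-* B b m ⟩
      m * (B * b) ≤⟨ *-monoʳ-≤ m abundant ⟩
      m * sum (quotients k J) ≡⟨ sum-map-* m (quotients k J) ⟨
      sum (map (m *_) (quotients k J))
        ≤⟨ unique-sum-≤ ys (Unique.map⁺ (*-cancelˡ-≡ _ _ m) (quotients-unique k J)) member ⟩
      sum ys ∎
      where
      open ≤-Reasoning
      swap-* : ∀ B b m → B * (b * m) ≡ m * (B * b)
      swap-* = solve-∀
      swap-*′ : ∀ q m x → q * (m * x) ≡ q * x * m
      swap-*′ = solve-∀
      member : ∀ {y} → y ∈ map (m *_) (quotients k J) → y ∈ ys
      member y∈ with ∈-map⁻ (m *_) y∈
      ... | x , x∈ , refl = complete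
        (*-cancelˡ-< q (m * x) d (begin-strict
          q * (m * x) ≡⟨ swap-*′ q m x ⟩
          q * x * m ≤⟨ *-monoˡ-≤ m (All.lookup (quotients-≤ k J) x∈) ⟩
          b * m <⟨ bm<qd ⟩
          q * d ∎))
        (∣-trans (subst (_∣ b * m) (*-comm x m) (*-monoˡ-∣ m (All.lookup (quotients-∣ k J) x∈))) bm∣a)

    w≤sum : w ≤ sum xs
    w≤sum = ≤-trans (m≤n+m w lo) (⇝-≤-sum (cover w ≤-refl))

    Δ : ℕ
    Δ = sum xs ∸ w

    Δ≤ : Δ ≤ C * w
    Δ≤ = ≤-trans (m∸n≤m (sum xs) w) sum≤

    -- All factors of `a` are 1 modulo `k` except `k′`, which is -1.
    k∣1+a : k ∣ suc a
    k∣1+a with One-* k (One-* k (base-One k J) (One-^ k α (1 , cong suc (sym (*-identityˡ k))))) (One-product k xs-One)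
    ... | s , eq = divides (1 + k′ * s) (begin
      suc (b * q ^ α * (k′ * product xs)) ≡⟨ cong suc (swap-* (b * q ^ α) k′ (product xs)) ⟩
      suc (k′ * (b * q ^ α * product xs)) ≡⟨ cong (λ y → suc (k′ * y)) eq ⟩
      suc (k′ * suc (s * suc k′)) ≡⟨ expand k′ s ⟩
      (1 + k′ * s) * k ∎)
      where
      open ≡-Reasoning
      swap-* : ∀ x y z → x * (y * z) ≡ y * (x * z)
      swap-* = solve-∀
      expand : ∀ k′ s → suc (k′ * suc (s * suc k′)) ≡ (1 + k′ * s) * suc k′
      expand = solve-∀

    dense : ∀ {d} ys → d ∣ a → w < d → (∀ {x} → x < d → x ∣ a → x ∈ ys) → d + Δ ≤ sum ys
    dense {d} ys d∣a w<d complete = begin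
      d + Δ ≤⟨ +-monoʳ-≤ d (≤-trans Δ≤ (*-monoʳ-≤ C (<⇒≤ w<d))) ⟩
      d + C * d ≤⟨ m≤m+n (d + C * d) (C * d) ⟩
      d + C * d + C * d ≡⟨ regroup d C ⟩
      B * d ≤⟨ abundant-below ys d∣a w<d complete ⟩
      sum ys ∎
      where
      open ≤-Reasoning
      regroup : ∀ d C → d + C * d + C * d ≡ (1 + 2 * C) * d
      regroup = solve-∀

    2Δ≤σ : 2 * Δ ≤ σ a
    2Δ≤σ = begin
      2 * Δ ≤⟨ *-monoʳ-≤ 2 (≤-trans Δ≤ (*-monoʳ-≤ C (<⇒≤ w<a))) ⟩
      2 * (C * a) ≡⟨ *-assoc 2 C a ⟨
      2 * C * a ≤⟨ m≤n+m (2 * C * a) a ⟩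
      -- Here `d` is `a` itself.
      B * a ≤⟨ abundant-below (divisors a) ∣-refl w<a (λ _ → ∈-divisors⁺) ⟩
      σ a ∎
      where open ≤-Reasoning

    xs∣a : All (_∣ a) xs
    xs∣a = All.tabulate λ x∈ → ∣-trans (∈⇒∣product x∈) (∣-trans (n∣m*n k′) (n∣m*n (b * q ^ α)))

    zumkeller-a : Zumkeller a
    zumkeller-a = Fill.zumkeller a xs lo w Δ xs-unique xs∣a cover (m+[n∸m]≡n w≤sum) dense
      (∣-trans 4∣k k∣1+a) 2Δ≤σ

  zumkeller-class : ∃ λ a → Zumkeller a × k ∣ suc a
  zumkeller-class =
    let J , abundant = abundance k B
        xs , lo , w , xs-unique , xs-One , b≤w , cover , sum≤ = wide-cover k (base k J)
        module C = Construct J abundant xs lo w xs-unique xs-One b≤w cover sum≤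
    in C.a , C.zumkeller-a , C.k∣1+a

-- Refining arithmetic progressions

-- a³ + 1 = (a + 1) (a² - a + 1) shows that 4 * S * (a² - a + 1) inverts M modulo a² when
-- a + 1 = 4 * M * S; the multiplier x satisfies c + x ≡ a (mod a²).
crt-step : ∀ a M S c .{{_ : NonZero a}} → suc a ≡ S * (4 * M) →
  ∃ λ y → ∃ λ z → c + M * y ≡ a * suc (a * z)
crt-step a@(suc p) M S c 1+a≡ = 4 * (S * (a * p + 1)) * x , c + a * x , (begin
  c + M * (4 * (S * (a * p + 1)) * x) ≡⟨ cong (c +_) (regroup M S (a * p + 1) x) ⟩
  c + S * (4 * M) * (a * p + 1) * x ≡⟨ cong (λ z → c + z * (a * p + 1) * x) 1+a≡ ⟨
  c + suc a * (a * p + 1) * x ≡⟨ cube c p x ⟩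
  c + x + a * a * a * x ≡⟨ cong (_+ a * a * a * x) (residue c p) ⟩
  a + c * (a * a) + a * a * a * x ≡⟨ factor a c x ⟩
  a * suc (a * (c + a * x)) ∎)
  where
  open ≡-Reasoning
  x = a + c * (p * (2 + p))
  regroup : ∀ M S z x → M * (4 * (S * z) * x) ≡ S * (4 * M) * z * x
  regroup = solve-∀
  cube : ∀ c p x → c + suc (suc p) * (suc p * p + 1) * x ≡ c + x + suc p * suc p * suc p * x
  cube = solve-∀
  residue : ∀ c p → c + (suc p + c * (p * (2 + p))) ≡ suc p + c * (suc p * suc p)
  residue = solve-∀
  factor : ∀ a c x → a + c * (a * a) + a * a * a * x ≡ a * suc (a * (c + a * x))
  factor = solve-∀

coprime-suc-* : ∀ a z → Coprime a (suc (a * z))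
coprime-suc-* a z {i} (i∣a , i∣1+az) =
  ∣1⇒≡1 (∣m+n∣m⇒∣n (subst (i ∣_) (+-comm 1 (a * z)) i∣1+az) (∣m⇒∣m*n z i∣a))

zumkeller-class-* : ∀ M .{{_ : NonZero M}} → ∃ λ a → Zumkeller a × 4 * M ∣ suc a
-- `4 * suc M′` computes to the successor of the argument given for `k′`.
zumkeller-class-* (suc M′) = zumkeller-class (M′ + 3 * suc M′) (m∣m*n {4} (suc M′))

-- A whole progression is kept, so that a condition for the next shift can be imposed on `t` without
-- losing the earlier ones.
Progression : ℕ → Set
Progression m = ∃ λ n → ∃ λ M → NonZero M × (∀ t i → 1 ≤ i → i ≤ m → Zumkeller (n + M * t + i))

-- The earlier shifts are inherited at parameter `y + a * a * t`. The new shift is `a` times a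
-- number congruent to 1 modulo `a`, so `zumkeller-*` applies.
refine-progression : ∀ m → Progression m → Progression (suc m)
refine-progression m (n , M , M≢0 , zum) = construct (zumkeller-class-* M {{M≢0}})
  where
  refine : ∀ a y z → Zumkeller a →
    n + suc m + M * y ≡ a * suc (a * z) →
    ∀ t i → 1 ≤ i → i ≤ suc m → Zumkeller (n + M * y + M * (a * a) * t + i)
  refine a y z zum-a eq t i 1≤i i≤1+m with m≤n⇒m<n∨m≡n i≤1+m
  ... | inj₁ (s≤s i≤m) = subst Zumkeller (regroup n M y a t i) (zum (y + a * a * t) i 1≤i i≤m)
    where
    regroup : ∀ n M y a t i → n + M * (y + a * a * t) + i ≡ n + M * y + M * (a * a) * t + i
    regroup = solve-∀
  ... | inj₂ refl = subst Zumkeller (sym value)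
    (zumkeller-* a (suc (a * (z + M * t))) {{proj₁ zum-a}} (coprime-suc-* a (z + M * t)) zum-a)
    where
    open ≡-Reasoning
    regroup : ∀ n M y A t j → n + M * y + M * A * t + j ≡ n + j + M * y + M * A * t
    regroup = solve-∀
    factor : ∀ a z M t → a * suc (a * z) + M * (a * a) * t ≡ a * suc (a * (z + M * t))
    factor = solve-∀
    value : n + M * y + M * (a * a) * t + suc m ≡ a * suc (a * (z + M * t))
    value = begin
      n + M * y + M * (a * a) * t + suc m ≡⟨ regroup n M y (a * a) t (suc m) ⟩
      n + suc m + M * y + M * (a * a) * t ≡⟨ cong (_+ M * (a * a) * t) eq ⟩
      a * suc (a * z) + M * (a * a) * t ≡⟨ factor a z M t ⟩
      a * suc (a * (z + M * t)) ∎
  construct : (∃ λ a → Zumkeller a × 4 * M ∣ suc a) → Progression (suc m)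
  construct (a , zum-a@(a≢0 , _) , divides S 1+a≡) =
    let y , z , eq = crt-step a M S (n + suc m) {{a≢0}} 1+a≡
    in n + M * y , M * (a * a) , m*n≢0 M (a * a) {{M≢0}} {{m*n≢0 a a {{a≢0}} {{a≢0}}}}
       , refine a y z zum-a eq

zumkeller-progression : ∀ m → Progression m
zumkeller-progression zero = 0 , 1 , _ , λ t i 1≤i i≤0 → contradiction (≤-trans 1≤i i≤0) λ ()
zumkeller-progression (suc m) = refine-progression m (zumkeller-progression m)

theorem3p4 : ∀ (m : ℕ) → ∀ (N : ℕ) →
    ∃ λ (n : ℕ) → N ≤ n × (∀ (i : ℕ) → 1 ≤ i → i ≤ m → Zumkeller (n + i))
theorem3p4 m N = let n , M , M≢0 , zum = zumkeller-progression m in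
  -- The term with parameter `N` is at least `N` because `M` is positive.
  n + M * N , ≤-trans (m≤n*m N M {{M≢0}}) (m≤n+m (M * N) n) , zum N
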